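{- Let $m,n\in\mathbb{N}$ and let $a,b$ be integers with $0\le a\le n$ and $0\le b\le m$. Let $\mathcal{Z}=V_{a,b}$ be the zero-set defined by $\mathbb{Z}_+^2\setminus V_{a,b}=\{(x,y)\in\mathbb{Z}_+^2\colon x\ge a,\ y\ge b\}$. Then $\gamma(\mathcal{Z},m,n)=\max(am,bn)$.
   Context: $\mathbb{Z}_+=\{0,1,2,\dots\}$, $\mathbb{N}=\{1,2,\dots\}$, $[0,c]=\{0,1,\dots,c\}$, and $R_{a,b}=[0,a-1]\times[0,b-1]$. A zero-set (Young diagram) is a downward-closed set $\mathcal{Z}\subseteq\mathbb{Z}_+^2$ (if $(x,y)\in\mathcal{Z}$, $0\le x'\le x$, $0\le y'\le y$, then $(x',y')\in\mathcal{Z}$); $\emptyset$ and infinite sets are allowed. For $m,n\in\mathbb{N}$, the graph $K_m\Box K_n$ is represented on the vertex set $R_{n,m}=[0,n-1]\times[0,m-1]$, with two vertices adjacent iff they differ in exactly one coordinate. For $v=(j,i)\in R_{n,m}$, the row neighborhood $\mathcal{N}^r(v)$ is the set of all $(j',i)\in R_{n,m}$ with $j'\neq j$, and the column neighborhood $\mathcal{N}^c(v)$ is the set of all $(j,i')\in R_{n,m}$ with $i'\ne i$. Given $\mathcal{Z}$, for $A\subseteq R_{n,m}$ let $\mathcal{T}(A)=A\cup\{v\in R_{n,m}\setminus A\colon (|\mathcal{N}^r(v)\cap A|,|\mathcal{N}^c(v)\cap A|)\notin\mathcal{Z}\}$. Then $\gamma(\mathcal{Z},m,n)=\min\{|A|\colon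 A\subseteq R_{n,m},\ \mathcal{T}(A)=R_{n,m}\}$. -}

module Defs where

open import Level using (0ℓ)
open import Data.Bool.Base using (Bool; T; _∧_)
open import Data.Fin.Base using (Fin)
open import Data.Fin.Properties using (_≟_)
open import Data.List.Base using (length; filterᵇ; allFin; cartesianProduct)
open import Data.Nat.Base using (ℕ; _≤_)
open import Data.Nat.Properties using (≤-trans)
open import Data.Product.Base using (_×_; _,_; ∃-syntax)
open import Data.Sum.Base using (_⊎_)
open import Relation.Binary.PropositionalEquality using (_≡_)
open import Relation.Nullary.Decidable using (does; ¬?; _×-dec_)
open import Relation.Unary using (Pred; _∈_; _∉_; ∁; Universal)

record ZeroSet : Set₁ where
  field
    points     : Pred (ℕ × ℕ) 0ℓ
    downClosed : ∀ {x y x′ y′} → x′ ≤ x → y′ ≤ y →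
                 (x , y) ∈ points → (x′ , y′) ∈ points

open ZeroSet public

V : ℕ → ℕ → ZeroSet
V a b = record
  { points     = ∁ λ (x , y) → a ≤ x × b ≤ y
  ; downClosed = λ x′≤x y′≤y ∉ (a≤x′ , b≤y′) →
                   ∉ (≤-trans a≤x′ x′≤x , ≤-trans b≤y′ y′≤y)
  }

-- The vertex set R_{n,m} of K_m □ K_n: a vertex (j , i) has column index
-- j < n and row index i < m, so there are m rows of n vertices each.
Vertex : ℕ → ℕ → Set
Vertex m n = Fin n × Fin m

-- Subsets of the (finite) vertex set, given by characteristic functions.
VertexSet : ℕ → ℕ → Set
VertexSet m n = Vertex m n → Bool

module _ {m n : ℕ} where

  ⟨_⟩ : VertexSet m n → Pred (Vertex m n) 0ℓ
  ⟨ A ⟩ v = T (A v)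

  -- cartesianProduct (allFin n) (allFin m) lists every vertex exactly once.
  ∣_∣ : VertexSet m n → ℕ
  ∣ A ∣ = length (filterᵇ A (cartesianProduct (allFin n) (allFin m)))

  infixr 7 _∩_
  _∩_ : VertexSet m n → VertexSet m n → VertexSet m n
  (A ∩ B) v = A v ∧ B v

  𝒩ʳ 𝒩ᶜ : Vertex m n → VertexSet m n
  𝒩ʳ (j , i) (j′ , i′) = does (¬? (j′ ≟ j) ×-dec (i′ ≟ i))
  𝒩ᶜ (j , i) (j′ , i′) = does ((j′ ≟ j) ×-dec ¬? (i′ ≟ i))

  -- A predicate rather than a VertexSet, as membership in 𝒵 need not be
  -- decidable.
  𝒯 : ZeroSet → VertexSet m n → Pred (Vertex m n) 0ℓ
  𝒯 𝒵 A v = v ∈ ⟨ A ⟩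
          ⊎ (v ∉ ⟨ A ⟩ × (∣ 𝒩ʳ v ∩ A ∣ , ∣ 𝒩ᶜ v ∩ A ∣) ∉ points 𝒵)

IsMinimum : Pred ℕ 0ℓ → ℕ → Set
IsMinimum P k = k ∈ P × (∀ {l} → l ∈ P → k ≤ l)

-- The sizes |A| of the sets A ⊆ R_{n,m} with 𝒯(A) = R_{n,m}.
SpanningSize : ZeroSet → (m n : ℕ) → Pred ℕ 0ℓ
SpanningSize 𝒵 m n k =
  ∃[ A ] (Universal (𝒯 {m} {n} 𝒵 A) × ∣ A ∣ ≡ k)

-- γ[ 𝒵 , m , n ]≡ k expresses γ(𝒵,m,n) = k. The minimum is given as a
-- relation because for undecidable 𝒵 it cannot be computed; k is unique by
-- antisymmetry of ≤.
γ[_,_,_]≡_ : ZeroSet → ℕ → ℕ → ℕ → Set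
γ[ 𝒵 , m , n ]≡ k = IsMinimum (SpanningSize 𝒵 m n) k

{-# OPTIONS --safe #-}

-- Lower bound: a vertex v ∉ A forces at least a elements of A in its row and
-- b in its column, while a full row has n ≥ a elements and a full column
-- m ≥ b; hence every row of A has at least a elements and every column at
-- least b.
--
-- Upper bound: conversely such an A spans, so by symmetry it suffices, when
-- b n ≤ a m, to find an A with exactly a elements in every row and at least b
-- in every column. Deal the numbers 0, 1, …, a m − 1 to the rows, a consecutive
-- ones to each, placing every number in the column of its residue mod n. As
-- a ≤ n no place is used twice, and each column gets at least ⌊a m / n⌋ ≥ b.
module Submission where

open import Data.Bool.Base using (Bool; true; false; T; _∧_; if_then_else_)
open import Data.Bool.Properties using (T?)
open import Data.Fin.Base using (Fin; zero; suc; toℕ)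
open import Data.Fin.Properties using (_≟_; all?; toℕ<n; ¬∀⟶∃¬; punchInᵢ≢i)
open import Data.List.Base using (length; filterᵇ; map; _++_; tabulate; cartesianProduct)
open import Data.List.Properties using (filter-++; length-++; map-tabulate)
open import Data.Nat.Base using (ℕ; zero; suc; NonZero; _≤_; _*_; _+_; _⊔_; _/_; z≤n)
open import Data.Nat.DivMod using (/-monoˡ-≤; m*n/n≡m; m<n⇒m/n≡0; n/n≡1; +-distrib-/-∣ʳ)
open import Data.Nat.Divisibility using (∣-refl)
open import Data.Nat.Properties
  using ( +-0-commutativeMonoid; _≤?_; _<?_; module ≤-Reasoning; ≤-refl; ≤-reflexive; ≤-antisym
        ; ≤-trans; ≤-total; m≤n⇒m<n∨m≡n; <-irrefl; +-mono-≤; +-monoˡ-≤; m≤m+n; m≤n+m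
        ; +-comm; +-assoc; +-suc; +-identityʳ; +-cancelʳ-≡; *-comm; *-identityʳ; ⊔-lub; m≥n⇒m⊔n≡m
        ; m≤n⇒m⊔n≡n )
open import Data.Nat.Solver using (module +-*-Solver)
open import Data.Product.Base using (_×_; _,_; proj₁; proj₂; swap)
open import Data.Sum.Base using (inj₁; inj₂; [_,_]′)
open import Data.Vec.Functional using (removeAt)
open import Function.Base using (_∘_; id)
open import Relation.Binary.PropositionalEquality
  using (_≡_; _≢_; refl; sym; trans; cong; cong₂; subst; module ≡-Reasoning)
open import Relation.Nullary.Decidable
  using (Dec; does; yes; no; ¬?; _×-dec_; dec-true; dec-false; decidable-stable)
open import Relation.Nullary.Negation using (¬_; contradiction)
open import Relation.Unary using (Universal)
open import Algebra.Properties.CommutativeMonoid.Sum +-0-commutativeMonoid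
  using (sum; sum-syntax; sum-cong-≗; sum-replicate-zero; sum-remove; ∑-distrib-+; ∑-comm)
open import Defs

-- Finite sums of natural numbers

sum-lower : ∀ {n c} (f : Fin n → ℕ) → (∀ i → c ≤ f i) → n * c ≤ sum f
sum-lower {zero}  f c≤f = z≤n
sum-lower {suc n} f c≤f = +-mono-≤ (c≤f zero) (sum-lower (f ∘ suc) (c≤f ∘ suc))

sum-const : ∀ {n c} (f : Fin n → ℕ) → (∀ i → f i ≡ c) → sum f ≡ n * c
sum-const {zero}  f f≡c = refl
sum-const {suc n} f f≡c = cong₂ _+_ (f≡c zero) (sum-const (f ∘ suc) (f≡c ∘ suc))

sum-concentrated : ∀ {n} (f : Fin n → ℕ) i → (∀ j → j ≢ i → f j ≡ 0) → sum f ≡ f i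
sum-concentrated {suc n} f i f≡0 = begin
  sum f                      ≡⟨ sum-remove {i = i} f ⟩
  f i + sum (removeAt f i)   ≡⟨ cong (f i +_) (sum-cong-≗ {n} λ j → f≡0 _ (punchInᵢ≢i i j)) ⟩
  f i + sum {n} (λ _ → 0)    ≡⟨ cong (f i +_) (sum-replicate-zero n) ⟩
  f i + 0                    ≡⟨ +-identityʳ (f i) ⟩
  f i                        ∎
  where open ≡-Reasoning

-- Hypothesis and conclusion add values of `F` rather than subtract them, since subtraction on `ℕ`
-- truncates.
sum-telescope : ∀ {n} (F : ℕ → ℕ) (f : Fin n → ℕ) →
                (∀ i → f i + F (toℕ i) ≡ F (suc (toℕ i))) → sum f + F 0 ≡ F n
sum-telescope {zero}  F f step = refl
sum-telescope {suc n} F f step = begin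
  f zero + sum (f ∘ suc) + F 0
    ≡⟨ solve 3 (λ x y z → x :+ y :+ z := y :+ (x :+ z)) refl (f zero) _ (F 0) ⟩
  sum (f ∘ suc) + (f zero + F 0)  ≡⟨ cong (sum (f ∘ suc) +_) (step zero) ⟩
  sum (f ∘ suc) + F 1             ≡⟨ sum-telescope (F ∘ suc) (f ∘ suc) (step ∘ suc) ⟩
  F (suc n)                       ∎
  where
  open ≡-Reasoning
  open +-*-Solver

-- Both sides are `h 0 + h 1 + … + h n`, with a different end term split off.
sum-shift : ∀ n (h : ℕ → ℕ) →
            ∑[ j < n ] h (suc (toℕ j)) + h 0 ≡ ∑[ j < n ] h (toℕ j) + h n
sum-shift zero    h = refl
sum-shift (suc n) h = begin
  h 1 + S₂ + h 0          ≡⟨ solve 3 (λ x y z → x :+ y :+ z := z :+ (y :+ x)) refl (h 1) S₂ (h 0) ⟩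
  h 0 + (S₂ + h 1)        ≡⟨ cong (h 0 +_) (sum-shift n (h ∘ suc)) ⟩
  h 0 + (S₁ + h (suc n))  ≡⟨ +-assoc (h 0) S₁ _ ⟨
  h 0 + S₁ + h (suc n)    ∎
  where
  open ≡-Reasoning
  open +-*-Solver
  S₁ = ∑[ j < n ] h (suc (toℕ j))
  S₂ = ∑[ j < n ] h (suc (suc (toℕ j)))

-- Floor division and Hermite's identity

[m+n]/n≡1+m/n : ∀ m n .{{_ : NonZero n}} → (m + n) / n ≡ suc (m / n)
[m+n]/n≡1+m/n m n = begin
  (m + n) / n    ≡⟨ +-distrib-/-∣ʳ m ∣-refl ⟩
  m / n + n / n  ≡⟨ cong (m / n +_) (n/n≡1 n) ⟩
  m / n + 1      ≡⟨ +-comm (m / n) 1 ⟩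
  suc (m / n)    ∎
  where open ≡-Reasoning

-- Induction on `x`: raising `x` by one shifts the summation index, which trades the term `x / n`
-- for `(x + n) / n`, larger by exactly one.
hermite : ∀ n .{{_ : NonZero n}} x → ∑[ j < n ] ((x + toℕ j) / n) ≡ x
hermite n zero    = trans (sum-cong-≗ λ j → m<n⇒m/n≡0 (toℕ<n j)) (sum-replicate-zero n)
hermite n (suc x) = +-cancelʳ-≡ (x / n) _ _ (begin
  ∑[ j < n ] ((suc x + toℕ j) / n) + x / n
    -- Every term is brought to the form `(x + k) / n`, the separate one with `k = 0`, so that
    -- `sum-shift` applies.
    ≡⟨ cong₂ _+_ (sum-cong-≗ {n} λ j → cong (_/ n) (sym (+-suc x (toℕ j))))
           (cong (_/ n) (sym (+-identityʳ x))) ⟩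
  ∑[ j < n ] ((x + suc (toℕ j)) / n) + (x + 0) / n
    ≡⟨ sum-shift n (λ k → (x + k) / n) ⟩
  ∑[ j < n ] ((x + toℕ j) / n) + (x + n) / n
    ≡⟨ cong₂ _+_ (hermite n x) ([m+n]/n≡1+m/n x n) ⟩
  x + suc (x / n)
    ≡⟨ +-suc x (x / n) ⟩
  suc x + x / n ∎)
  where
  open ≡-Reasoning

-- Indicators and counting

𝟏 : Bool → ℕ
𝟏 b = if b then 1 else 0

-- Under these bounds `y` is `x` or `suc x`, so the indicator of a strict increase is the increase
-- itself.
𝟏-<? : ∀ {x y} → x ≤ y → y ≤ suc x → 𝟏 (does (x <? y)) + x ≡ y
𝟏-<? {x} {y} x≤y y≤1+x with m≤n⇒m<n∨m≡n x≤y
... | inj₁ x<y rewrite dec-true (x <? y) x<y = ≤-antisym x<y y≤1+x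
... | inj₂ refl rewrite dec-false (x <? x) (<-irrefl refl) = refl

𝟏-restrict : ∀ {P : Set} {c} (P? : Dec P) → (T c → P) → 𝟏 (does P? ∧ c) ≡ 𝟏 c
𝟏-restrict {c = false} (yes _) _  = refl
𝟏-restrict {c = false} (no _)  _  = refl
𝟏-restrict {c = true}  P?      c⇒P = cong (λ b → 𝟏 (b ∧ true)) (dec-true P? (c⇒P _))

𝟏-exclude : ∀ {P : Set} {c} (P? : Dec P) → ¬ P → 𝟏 (does P? ∧ c) ≡ 0
𝟏-exclude {c = c} P? ¬p = cong (λ b → 𝟏 (b ∧ c)) (dec-false P? ¬p)

-- Either `p` holds everywhere and the count is at least `n`, or some `i` fails `p` and `bound`
-- applies to it.
count-lower : ∀ {n a} (p : Fin n → Bool) → a ≤ n →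
              (∀ i → ¬ T (p i) → a ≤ ∑[ j < n ] 𝟏 (p j)) → a ≤ ∑[ j < n ] 𝟏 (p j)
count-lower {n} p a≤n bound with all? (λ i → T? (p i))
... | yes all = ≤-trans a≤n
  (subst (_≤ ∑[ j < n ] 𝟏 (p j)) (*-identityʳ n) (sum-lower _ (λ i → T⇒1≤𝟏 (all i))))
  where
  T⇒1≤𝟏 : ∀ {b} → T b → 1 ≤ 𝟏 b
  T⇒1≤𝟏 {true} _ = ≤-refl
... | no ¬all with i , ¬pᵢ ← ¬∀⟶∃¬ n _ (λ i → T? (p i)) ¬all = bound i ¬pᵢ

length-filterᵇ-tabulate : ∀ {X : Set} {n} (p : X → Bool) (f : Fin n → X) →
                          length (filterᵇ p (tabulate f)) ≡ ∑[ i < n ] 𝟏 (p (f i))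
length-filterᵇ-tabulate {n = zero}  p f = refl
length-filterᵇ-tabulate {n = suc n} p f with p (f zero)
... | true  = cong suc (length-filterᵇ-tabulate p (f ∘ suc))
... | false = length-filterᵇ-tabulate p (f ∘ suc)

length-filterᵇ-cartesianProduct :
  ∀ {X Y : Set} {n m} (p : X × Y → Bool) (f : Fin n → X) (g : Fin m → Y) →
  length (filterᵇ p (cartesianProduct (tabulate f) (tabulate g))) ≡
  ∑[ j < n ] ∑[ i < m ] 𝟏 (p (f j , g i))
length-filterᵇ-cartesianProduct {n = zero}      p f g = refl
length-filterᵇ-cartesianProduct {n = suc n} {m} p f g = begin
  length (filterᵇ p (firstRow ++ rest))
    ≡⟨ cong length (filter-++ (T? ∘ p) firstRow rest) ⟩
  length (filterᵇ p firstRow ++ filterᵇ p rest)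
    ≡⟨ length-++ (filterᵇ p firstRow) ⟩
  length (filterᵇ p firstRow) + length (filterᵇ p rest)
    ≡⟨ cong₂ _+_
         (trans (cong (length ∘ filterᵇ p) (map-tabulate g (f zero ,_)))
                (length-filterᵇ-tabulate p ((f zero ,_) ∘ g)))
         (length-filterᵇ-cartesianProduct p (f ∘ suc) g) ⟩
  ∑[ j < suc n ] ∑[ i < m ] 𝟏 (p (f j , g i)) ∎
  where
  open ≡-Reasoning
  firstRow = map (f zero ,_) (tabulate g)
  rest     = cartesianProduct (tabulate (f ∘ suc)) (tabulate g)

-- Row and column counts, and spanning in terms of them

module _ {m n : ℕ} (A : VertexSet m n) where

  rowCount : Fin m → ℕ
  rowCount i = ∑[ j < n ] 𝟏 (A (j , i))

  columnCount : Fin n → ℕ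
  columnCount j = ∑[ i < m ] 𝟏 (A (j , i))

  ∣∣-columns : ∣ A ∣ ≡ sum columnCount
  ∣∣-columns = length-filterᵇ-cartesianProduct A id id

  ∣∣-rows : ∣ A ∣ ≡ sum rowCount
  ∣∣-rows = trans ∣∣-columns (∑-comm λ j i → 𝟏 (A (j , i)))

module _ {m n : ℕ} (A : VertexSet m n) {j : Fin n} {i : Fin m} (v∉A : ¬ T (A (j , i))) where

  -- Only row `i` contributes to the inner sums, and there the condition `j′ ≢ j` excludes nothing
  -- of `A`, because `(j , i)` is not in `A`.
  ∣𝒩ʳ∩∣ : ∣ 𝒩ʳ (j , i) ∩ A ∣ ≡ rowCount A i
  ∣𝒩ʳ∩∣ = trans (∣∣-columns (𝒩ʳ (j , i) ∩ A)) (sum-cong-≗ λ j′ → trans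
    (sum-concentrated _ i λ i′ i′≢i → 𝟏-exclude (¬? (j′ ≟ j) ×-dec (i′ ≟ i)) (i′≢i ∘ proj₂))
    (𝟏-restrict (¬? (j′ ≟ j) ×-dec (i ≟ i)) λ v′∈A → (λ { refl → v∉A v′∈A }) , refl))

  ∣𝒩ᶜ∩∣ : ∣ 𝒩ᶜ (j , i) ∩ A ∣ ≡ columnCount A j
  ∣𝒩ᶜ∩∣ = trans (∣∣-rows (𝒩ᶜ (j , i) ∩ A)) (sum-cong-≗ λ i′ → trans
    (sum-concentrated _ j λ j′ j′≢j → 𝟏-exclude ((j′ ≟ j) ×-dec ¬? (i′ ≟ i)) (j′≢j ∘ proj₁))
    (𝟏-restrict ((j ≟ j) ×-dec ¬? (i′ ≟ i)) λ v′∈A → refl , (λ { refl → v∉A v′∈A })))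

module _ {m n a b : ℕ} (A : VertexSet m n) where

  spanning⇒counts : a ≤ n → b ≤ m → Universal (𝒯 (V a b) A) →
                    (∀ i → a ≤ rowCount A i) × (∀ j → b ≤ columnCount A j)
  spanning⇒counts a≤n b≤m spans =
    (λ i → count-lower (λ j → A (j , i)) a≤n λ j v∉A → proj₁ (bounds v∉A)) ,
    (λ j → count-lower (λ i → A (j , i)) b≤m λ i v∉A → proj₂ (bounds v∉A))
    where
    bounds : ∀ {j i} → ¬ T (A (j , i)) → a ≤ rowCount A i × b ≤ columnCount A j
    bounds {j} {i} v∉A with spans (j , i)
    ... | inj₁ v∈A       = contradiction v∈A v∉A
    -- `V a b` is defined as a complement, so lying outside it is a double negation; it can be
    -- removed because `≤` is decidable.
    ... | inj₂ (_ , ¬¬p) = decidable-stable ((a ≤? _) ×-dec (b ≤? _))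
      (¬¬p ∘ λ ¬p (a≤ , b≤) → ¬p (subst (a ≤_) (∣𝒩ʳ∩∣ A v∉A) a≤ , subst (b ≤_) (∣𝒩ᶜ∩∣ A v∉A) b≤))

  counts⇒spanning : (∀ i → a ≤ rowCount A i) → (∀ j → b ≤ columnCount A j) →
                    Universal (𝒯 (V a b) A)
  counts⇒spanning a≤ b≤ v@(j , i) with T? (A v)
  ... | yes v∈A = inj₁ v∈A
  ... | no  v∉A = inj₂ (v∉A , λ ∉V → ∉V
    (subst (a ≤_) (sym (∣𝒩ʳ∩∣ A v∉A)) (a≤ i) , subst (b ≤_) (sym (∣𝒩ᶜ∩∣ A v∉A)) (b≤ j)))

-- The balanced set

module _ (m n : ℕ) .{{_ : NonZero n}} {a : ℕ} (a≤n : a ≤ n) where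

  -- The number of k < x with k ≡ n − 1 − j mod n.
  dealt : ℕ → ℕ → ℕ
  dealt j x = (x + j) / n

  -- Row `i` receives the numbers from `i * a` up to `suc i * a`, the latter excluded; a vertex is
  -- chosen when its column's tally rises during that block.
  balanced : VertexSet m n
  balanced (j , i) = does (dealt (toℕ j) (toℕ i * a) <? dealt (toℕ j) (suc (toℕ i) * a))

  -- A block of `a ≤ n` consecutive numbers meets each residue class at most once, so the tally
  -- rises by zero or one.
  balanced-step : ∀ j i → 𝟏 (balanced (j , i)) + dealt (toℕ j) (toℕ i * a) ≡
                          dealt (toℕ j) (suc (toℕ i) * a)
  balanced-step j i = 𝟏-<? (/-monoˡ-≤ n (+-monoˡ-≤ (toℕ j) (m≤n+m x a))) (begin
    (a + x + toℕ j) / n    ≤⟨ /-monoˡ-≤ n (+-monoˡ-≤ (toℕ j) (+-monoˡ-≤ x a≤n)) ⟩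
    (n + x + toℕ j) / n    ≡⟨ cong (_/ n) (trans (+-assoc n x (toℕ j)) (+-comm n _)) ⟩
    (x + toℕ j + n) / n    ≡⟨ [m+n]/n≡1+m/n (x + toℕ j) n ⟩
    suc (dealt (toℕ j) x)  ∎)
    where
    open ≤-Reasoning
    x = toℕ i * a

  -- By `hermite` the tallies of all columns add up to `x` before the row is dealt and to `a + x`
  -- after it.
  balanced-rowCount : ∀ i → rowCount balanced i ≡ a
  balanced-rowCount i = +-cancelʳ-≡ x _ _ (begin
    rowCount balanced i + x
      ≡⟨ cong (rowCount balanced i +_) (hermite n x) ⟨
    rowCount balanced i + ∑[ j < n ] dealt (toℕ j) x
      ≡⟨ ∑-distrib-+ (λ j → 𝟏 (balanced (j , i))) (λ j → dealt (toℕ j) x) ⟨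
    ∑[ j < n ] (𝟏 (balanced (j , i)) + dealt (toℕ j) x)
      ≡⟨ sum-cong-≗ (λ j → balanced-step j i) ⟩
    ∑[ j < n ] dealt (toℕ j) (a + x)
      ≡⟨ hermite n (a + x) ⟩
    a + x ∎)
    where
    open ≡-Reasoning
    x = toℕ i * a

  -- The increases telescope over the rows, starting from `toℕ j / n`, which is zero as `toℕ j` is
  -- below `n`.
  balanced-columnCount : ∀ j → columnCount balanced j ≡ dealt (toℕ j) (m * a)
  balanced-columnCount j = begin
    columnCount balanced j
      ≡⟨ +-identityʳ _ ⟨
    columnCount balanced j + 0
      ≡⟨ cong (columnCount balanced j +_) (m<n⇒m/n≡0 (toℕ<n j)) ⟨
    columnCount balanced j + dealt (toℕ j) 0
      ≡⟨ sum-telescope (λ k → dealt (toℕ j) (k * a)) _ (balanced-step j) ⟩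
    dealt (toℕ j) (m * a) ∎
    where open ≡-Reasoning

  balanced-columnCount-≥ : ∀ {b} → b * n ≤ a * m → ∀ j → b ≤ columnCount balanced j
  balanced-columnCount-≥ {b} bn≤am j = begin
    b                       ≡⟨ m*n/n≡m b n ⟨
    b * n / n               ≤⟨ /-monoˡ-≤ n bn≤am ⟩
    a * m / n               ≡⟨ cong (_/ n) (*-comm a m) ⟩
    m * a / n               ≤⟨ /-monoˡ-≤ n (m≤m+n (m * a) (toℕ j)) ⟩
    dealt (toℕ j) (m * a)   ≡⟨ balanced-columnCount j ⟨
    columnCount balanced j  ∎
    where open ≤-Reasoning

-- The minimum: a lower bound, and a witness for either order of `a * m` and `b * n`

proposition1p1 : ∀ (m n : ℕ) .{{_ : NonZero m}} .{{_ : NonZero n}} (a b : ℕ) →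
    a ≤ n → b ≤ m → γ[ V a b , m , n ]≡ (a * m ⊔ b * n)
proposition1p1 m n a b a≤n b≤m = [ rows , columns ]′ (≤-total (b * n) (a * m)) , lower
  where
  lower : ∀ {l} → SpanningSize (V a b) m n l → a * m ⊔ b * n ≤ l
  lower (A , spans , refl) with a≤rows , b≤columns ← spanning⇒counts A a≤n b≤m spans = ⊔-lub
    (begin
      a * m                ≡⟨ *-comm a m ⟩
      m * a                ≤⟨ sum-lower _ a≤rows ⟩
      sum (rowCount A)     ≡⟨ ∣∣-rows A ⟨
      ∣ A ∣                ∎)
    (begin
      b * n                ≡⟨ *-comm b n ⟩
      n * b                ≤⟨ sum-lower _ b≤columns ⟩
      sum (columnCount A)  ≡⟨ ∣∣-columns A ⟨
      ∣ A ∣                ∎)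
    where open ≤-Reasoning

  open ≡-Reasoning

  rows : b * n ≤ a * m → SpanningSize (V a b) m n (a * m ⊔ b * n)
  rows bn≤am = A , counts⇒spanning A
    (≤-reflexive ∘ sym ∘ balanced-rowCount m n a≤n)
    (balanced-columnCount-≥ m n a≤n bn≤am) ,
    (begin
      ∣ A ∣             ≡⟨ ∣∣-rows A ⟩
      sum (rowCount A)  ≡⟨ sum-const _ (balanced-rowCount m n a≤n) ⟩
      m * a             ≡⟨ *-comm m a ⟩
      a * m             ≡⟨ m≥n⇒m⊔n≡m bn≤am ⟨
      a * m ⊔ b * n     ∎)
    where A = balanced m n a≤n

  columns : a * m ≤ b * n → SpanningSize (V a b) m n (a * m ⊔ b * n)
  columns am≤bn = A , counts⇒spanning A
    (balanced-columnCount-≥ n m b≤m am≤bn)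
    (≤-reflexive ∘ sym ∘ balanced-rowCount n m b≤m) ,
    (begin
      ∣ A ∣                ≡⟨ ∣∣-columns A ⟩
      sum (columnCount A)  ≡⟨ sum-const _ (balanced-rowCount n m b≤m) ⟩
      n * b                ≡⟨ *-comm n b ⟩
      b * n                ≡⟨ m≤n⇒m⊔n≡n am≤bn ⟨
      a * m ⊔ b * n        ∎)
    where
    A : VertexSet m n
    -- `swap` exchanges rows and columns, so each column has exactly `b` elements and the row counts
    -- of `A` are column counts of `balanced n m b≤m`.
    A = balanced n m b≤m ∘ swap
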